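{- Let $W$ be a set of eight distinct MacMahon cubes such that $G_W$ has eight edges, and let $n$ be the number of connected components of $G_W$. If none of the $n$ connected components is a tree, then the solution number of $W$ for the target $\mathrm{Ba}$ is $2^n$; otherwise it is $0$.
   Context: A MacMahon cube is a cube whose six faces are painted with the colors $1,\dots,6$, each used once, up to rotation (there are $30$ of them). At each vertex three faces meet; reading their colors clockwise as seen from outside gives a cyclic triple, and the corner number of the vertex is the cyclic rotation of this triple of smallest three-digit value; each MacMahon cube has $8$ distinct corner numbers. $\mathrm{Ba}$ denotes the MacMahon cube whose corner numbers are $\{123,134,146,162,253,265,354,456\}$. Every MacMahon cube other than $\mathrm{Ba}$ shares either $0$ or exactly $2$ corner numbers with $\mathrm{Ba}$. $M$ is the multigraph whose vertex set is the $8$ corner numbers of $\mathrm{Ba}$, with one edge, labeled $C$, joining the two shared corner numbers for each MacMahon cube $C\neq\mathrm{Ba}$ sharing exactly two corner numbers with $\mathrm{Ba}$ ($20$ edges, no loops, some parallel pairs). For a set $W$ of MacMahon cubes, $G_W$ is the subgraph of $M$ with all $8$ vertices and exactly the edges labeled by cubes in $W$. A solution for target $\mathrm{Ba}$ is a bijection $\sigma$ from $W$ to the corner numbers of $\mathrm{Ba}$ with $\sigma(C)$ a corner number of $C$ for all $C\in W$; the solution number is the number of such bijections. An isolated vertex counts as a tree component. -}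

module Defs where

open import Data.Nat using (ℕ; zero; suc; _+_; _*_)
import Data.Nat as ℕ
open import Data.Bool using (Bool; true; false; if_then_else_)
open import Data.Fin using (Fin; toℕ)
open import Data.Fin.Properties using (all?; any?)
open import Data.Vec using (Vec; []; _∷_; lookup; _∷ʳ_)
import Data.Vec as Vec
open import Data.List using (List; []; _∷_; map; concatMap; filter; length)
open import Data.List.Membership.Propositional using (_∈_)
open import Data.List.Membership.DecPropositional ℕ._≟_ using (_∈?_)
open import Data.List.Relation.Unary.Unique.Propositional using (Unique)
open import Data.List.Relation.Unary.Unique.DecPropositional (Data.Fin._≟_ {8}) using (unique?)
import Data.Vec.Membership.Propositional as VecMem
import Data.Vec.Membership.DecPropositional (Data.Fin._≟_ {8}) as VecDec
import Data.Fin
open import Data.Product using (Σ; ∃; _×_; _,_)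
open import Data.Sum using (_⊎_)
open import Relation.Binary.PropositionalEquality using (_≡_; _≢_)
open import Relation.Binary.Construct.Closure.ReflexiveTransitive using (Star)
open import Relation.Nullary using (¬_; Dec)
open import Relation.Nullary.Decidable using (_×-dec_)

-- Cube geometry.
-- Faces are numbered 0..5 :  0 = +x, 1 = -x, 2 = +y, 3 = -y, 4 = +z, 5 = -z
-- (right-handed coordinates).  A face colouring assigns to each face a colour
-- in Fin 6; colour k : Fin 6 stands for the colour (toℕ k + 1) ∈ {1,…,6}.

Face : Set
Face = Fin 6

Coloring : Set
Coloring = Vec (Fin 6) 6

IsMacMahon : Coloring → Set
IsMacMahon c = Unique (Vec.toList c)

-- The 8 vertices of the cube, each given by its three faces listed in
-- clockwise order as seen from outside the cube.
vertexFaces : Vec (Face × Face × Face) 8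
vertexFaces =
    (0F , 4F , 2F)   -- (+,+,+)
  ∷ (0F , 2F , 5F)   -- (+,+,-)
  ∷ (0F , 3F , 4F)   -- (+,-,+)
  ∷ (0F , 5F , 3F)   -- (+,-,-)
  ∷ (1F , 2F , 4F)   -- (-,+,+)
  ∷ (1F , 5F , 2F)   -- (-,+,-)
  ∷ (1F , 4F , 3F)   -- (-,-,+)
  ∷ (1F , 3F , 5F)   -- (-,-,-)
  ∷ []
  where
  open Data.Fin using (#_)
  0F 1F 2F 3F 4F 5F : Face
  0F = # 0
  1F = # 1
  2F = # 2
  3F = # 3
  4F = # 4
  5F = # 5

digits : ℕ → ℕ → ℕ → ℕ
digits a b c = 100 * a + 10 * b + c

cornerNumber : ℕ → ℕ → ℕ → ℕ
cornerNumber a b c =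
  ℕ._⊓_ (digits a b c) (ℕ._⊓_ (digits b c a) (digits c a b))

colour : Coloring → Face → ℕ
colour col f = suc (toℕ (lookup col f))

corners : Coloring → List ℕ
corners col = Vec.toList (Vec.map cn vertexFaces)
  where
  cn : Face × Face × Face → ℕ
  cn (f , g , h) = cornerNumber (colour col f) (colour col g) (colour col h)

-- Rotations.  Two quarter turns (about the z-axis and about the x-axis)
-- generate the rotation group of the cube; rotZ/rotX give the recoloured cube.

rotZ : Coloring → Coloring
rotZ c = lookup c (# 3) ∷ lookup c (# 2) ∷ lookup c (# 0) ∷ lookup c (# 1) ∷ lookup c (# 4) ∷ lookup c (# 5) ∷ []
  where open Data.Fin using (#_)

rotX : Coloring → Coloring
rotX c = lookup c (# 0) ∷ lookup c (# 1) ∷ lookup c (# 5) ∷ lookup c (# 4) ∷ lookup c (# 2) ∷ lookup c (# 3) ∷ []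
  where open Data.Fin using (#_)

RotStep : Coloring → Coloring → Set
RotStep c d = d ≡ rotZ c ⊎ d ≡ rotX c

SameCube : Coloring → Coloring → Set
SameCube = Star RotStep

-- The target Ba, given by its corner numbers; vertices of M are indexed by Fin 8.

BaCorners : Vec ℕ 8
BaCorners = 123 ∷ 134 ∷ 146 ∷ 162 ∷ 253 ∷ 265 ∷ 354 ∷ 456 ∷ []

BaCorner : Fin 8 → ℕ
BaCorner = lookup BaCorners

shared : Coloring → ℕ
shared c = length (filter (_∈? corners c) (Vec.toList BaCorners))

-- a cube C gives an edge of M iff C ≠ Ba and C shares exactly two corner numbers
-- with Ba (sharing exactly two already forces C ≠ Ba, which shares all eight)
IsEdge : Coloring → Set
IsEdge c = shared c ≡ 2

-- The graph G_W for W = {W i | i : Fin 8}.  Edges are indexed by i : Fin 8.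

Family : Set
Family = Fin 8 → Coloring

numEdges : Family → ℕ
numEdges W = length (filter (λ i → shared (W i) ℕ.≟ 2) (Vec.toList (Vec.allFin 8)))

Joins : Family → Fin 8 → Fin 8 → Fin 8 → Set
Joins W i u v = IsEdge (W i) × u ≢ v × BaCorner u ∈ corners (W i) × BaCorner v ∈ corners (W i)

Adjacent : Family → Fin 8 → Fin 8 → Set
Adjacent W u v = ∃ λ i → Joins W i u v

Reachable : Family → Fin 8 → Fin 8 → Set
Reachable W = Star (Adjacent W)

IsComponentLabelling : Family → (n : ℕ) → (Fin 8 → Fin n) → Set
IsComponentLabelling W n comp =
  (∀ u v → (comp u ≡ comp v → Reachable W u v) × (Reachable W u v → comp u ≡ comp v))
  × (∀ (k : Fin n) → ∃ λ v → comp v ≡ k)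

rotL : ∀ {A : Set} {k} → Vec A (suc k) → Vec A (suc k)
rotL (x ∷ xs) = xs ∷ʳ x

record Cycle (W : Family) : Set where
  field
    len   : ℕ
    verts : Vec (Fin 8) (suc len)
    edges : Vec (Fin 8) (suc len)
    vertsDistinct : Unique (Vec.toList verts)
    edgesDistinct : Unique (Vec.toList edges)
    joins : ∀ j → Joins W (lookup edges j) (lookup verts j) (lookup (rotL verts) j)

-- the component with label c is a tree: it is connected (by definition of a
-- component) and contains no cycle
IsTreeComponent : (W : Family) (n : ℕ) → (Fin 8 → Fin n) → Fin n → Set
IsTreeComponent W n comp c =
  ¬ (Σ (Cycle W) λ cyc → ∀ j → comp (lookup (Cycle.verts cyc) j) ≡ c)

-- Solutions.  A map σ : W → corners of Ba is encoded as the vector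
-- (σ(W 0), …, σ(W 7)) of vertex indices.

allVecs : (k : ℕ) → List (Vec (Fin 8) k)
allVecs zero    = [] ∷ []
allVecs (suc k) = concatMap (λ x → map (x ∷_) (allVecs k)) (Vec.toList (Vec.allFin 8))

IsSolution : Family → Vec (Fin 8) 8 → Set
IsSolution W σ =
  (Unique (Vec.toList σ) × (∀ v → VecMem._∈_ v σ))
  × (∀ i → BaCorner (lookup σ i) ∈ corners (W i))

isSolution? : ∀ W σ → Dec (IsSolution W σ)
isSolution? W σ =
  (unique? (Vec.toList σ) ×-dec all? (λ v → VecDec._∈?_ v σ))
  ×-dec all? (λ i → BaCorner (lookup σ i) ∈? corners (W i))

solutionNumber : Family → ℕ
solutionNumber W = length (filter (isSolution? W) (allVecs 8))

{-# OPTIONS --safe #-}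
module Submission where

-- Let count es F be the number of bijections from a list es of edges onto the
-- complement of F that send every edge to one of its ends.  Add the edges one
-- at a time and keep track of the components, writing T for those that are
-- trees.  As long as no component has more edges than vertices, count es F is
-- 2 ^ (number of unicyclic components) if F consists of exactly one vertex of
-- each tree, and 0 otherwise: a new edge inside a tree makes it unicyclic and
-- leaves a choice of two ends, and a new edge from a tree to another component
-- leaves no choice.  A component with an excess of edges makes count es vanish,
-- and since |T| + |es| = |V| before and |T| + |es| > |V| after its appearance,
-- it forces a tree once |es| = |V|.

open import Defs
open import Data.Nat using (ℕ; zero; suc; _+_; _<_; _^_; s≤s)
open import Data.Nat.Properties using (≤-refl; +-suc; +-comm; +-identityʳ; +-cancelʳ-≡; <-irrefl; m≤n⇒m≤1+n)
import Data.Nat as ℕ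
open import Data.Nat.ListAction using (sum)
open import Data.Nat.ListAction.Properties using (sum-↭)
open import Data.Bool using (if_then_else_)
open import Data.Empty using (⊥)
open import Data.Fin using (Fin; zero; suc; _≟_)
open import Data.Fin.Properties using (all?)
open import Data.Vec using (Vec; []; _∷_; lookup; _∷ʳ_)
import Data.Vec as Vec
open import Data.Vec.Properties using (toList-∷ʳ)
open import Data.Vec.Membership.Propositional.Properties using (∈-toList⁺; ∈-toList⁻; ∈-lookup)
open import Data.List using (List; []; _∷_; [_]; _++_; map; foldr; take; concatMap; filter; length; tabulate; allFin)
open import Data.List.Properties using (length-++; length-map; length-tabulate; filter-++; filter-≐; filter-none; filter-notAll; map-id; map-∘)
open import Data.List.Membership.Propositional using (_∈_; _∉_; lose)
open import Data.List.Membership.Propositional.Properties using (∈-∃++; ∈-allFin; ∈-map⁺; ∈-map⁻; ∈-++⁺ˡ; ∈-++⁺ʳ; ∈-filter⁺; ∈-filter⁻)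
open import Data.List.Membership.Propositional.Properties.WithK using (unique∧set⇒bag)
import Data.List.Membership.DecPropositional as DecMembership
open import Data.List.Relation.Unary.All as All using (All; []; _∷_)
import Data.List.Relation.Unary.All.Properties as Allₚ
open import Data.List.Relation.Unary.AllPairs as AllPairs using ([]; _∷_)
open import Data.List.Relation.Unary.Any using (here; there)
open import Data.List.Relation.Unary.Unique.Propositional using (Unique)
import Data.List.Relation.Unary.Unique.Propositional.Properties as Uniqueₚ
import Data.List.Relation.Unary.Unique.DecPropositional as DecUnique
open import Data.List.Relation.Binary.BagAndSetEquality using (∼bag⇒↭)
open import Data.List.Relation.Binary.Permutation.Propositional using (_↭_; ↭-refl; ↭-sym; ↭-trans; ↭-reflexive; ↭-prep; ↭-swap; ↭⇒↭ₛ)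
open import Data.List.Relation.Binary.Permutation.Propositional.Properties using (∈-resp-↭; ↭-length; shift; drop-∷; ∷↭∷ʳ; ++⁺ʳ; ++-identityʳ; map⁺)
import Data.List.Relation.Binary.Permutation.Setoid.Properties as Permₛ
open import Data.Product using (_×_; _,_; ∃; ∃₂; proj₁; proj₂)
open import Data.Sum as Sum using (_⊎_; inj₁; inj₂; [_,_]′)
open import Function using (_∘_; id; _⇔_; mk⇔; Equivalence)
open import Relation.Binary.Construct.Closure.ReflexiveTransitive using (ε; _◅_)
open import Relation.Binary.PropositionalEquality using (_≡_; _≢_; refl; sym; trans; cong; cong₂; subst; setoid)
open import Relation.Nullary using (¬_; Dec; yes; no; does; contradiction)
open import Relation.Nullary.Decidable using (_×-dec_; _⊎-dec_; dec-true; dec-false)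
open import Relation.Unary using (Decidable; _≐_)

-- Lists without repetitions

module _ {A : Set} where

  Unique-resp-↭ : {xs ys : List A} → xs ↭ ys → Unique xs → Unique ys
  Unique-resp-↭ p = Permₛ.Unique-resp-↭ (setoid A) (↭⇒↭ₛ p)

  head∉tail : {x : A} {xs : List A} → Unique (x ∷ xs) → x ∉ xs
  head∉tail (x≢ ∷ _) x∈ = All.lookup x≢ x∈ refl

  Unique-∷ : {x : A} {xs : List A} → x ∉ xs → Unique xs → Unique (x ∷ xs)
  Unique-∷ x∉ u = Allₚ.¬Any⇒All¬ _ x∉ ∷ u

  ∈⇒↭∷ : {x : A} {xs : List A} → x ∈ xs → ∃ λ ys → xs ↭ x ∷ ys
  ∈⇒↭∷ {x} x∈ with ys , zs , refl ← ∈-∃++ x∈ = ys ++ zs , shift x ys zs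

Enumerates : ∀ {n} → List (Fin n) → Set
Enumerates xs = Unique xs × (∀ v → v ∈ xs)

enumerates? : ∀ {n} → Decidable (Enumerates {n})
enumerates? xs = DecUnique.unique? _≟_ xs ×-dec all? (λ v → DecMembership._∈?_ _≟_ v xs)

enumerates⇒↭ : ∀ {n} {xs : List (Fin n)} → Enumerates xs → xs ↭ allFin n
enumerates⇒↭ {n} (u , c) =
  ∼bag⇒↭ (unique∧set⇒bag u (Uniqueₚ.allFin⁺ n) (mk⇔ (λ _ → ∈-allFin _) (λ _ → c _)))

↭⇒enumerates : ∀ {n} {xs : List (Fin n)} → xs ↭ allFin n → Enumerates xs
↭⇒enumerates {n} p =
  Unique-resp-↭ (↭-sym p) (Uniqueₚ.allFin⁺ n) , λ v → ∈-resp-↭ (↭-sym p) (∈-allFin v)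

enumerates-resp-↭ : ∀ {n} {xs ys : List (Fin n)} → xs ↭ ys → Enumerates xs → Enumerates ys
enumerates-resp-↭ p (u , c) = Unique-resp-↭ p u , λ v → ∈-resp-↭ p (c v)

indicator : {P : Set} → Dec P → ℕ
indicator (yes _) = 1
indicator (no  _) = 0

indicator≡1 : {P : Set} (P? : Dec P) → P → indicator P? ≡ 1
indicator≡1 (yes _) _ = refl
indicator≡1 (no ¬p) p = contradiction p ¬p

indicator≢0⇒ : {P : Set} (P? : Dec P) → indicator P? ≢ 0 → P
indicator≢0⇒ (yes p) _  = p
indicator≢0⇒ (no _)  ne = contradiction refl ne

-- Merging two classes by redirecting a representative

module Redirect {N : ℕ} (r s : Fin N) where

  redirect : Fin N → Fin N
  redirect x = if does (x ≟ r) then s else x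

  redirect-hit : ∀ {x} → x ≡ r → redirect x ≡ s
  redirect-hit {x} p rewrite dec-true (x ≟ r) p = refl

  redirect-miss : ∀ {x} → x ≢ r → redirect x ≡ x
  redirect-miss {x} p rewrite dec-false (x ≟ r) p = refl

  redirect-≡ : ∀ {x y} → redirect x ≡ redirect y → (x ≡ y) ⊎ (x ≡ r × y ≡ s) ⊎ (x ≡ s × y ≡ r)
  redirect-≡ {x} {y} eq with x ≟ r | y ≟ r
  ... | yes p | yes q = inj₁ (trans p (sym q))
  ... | yes p | no  _ = inj₂ (inj₁ (p , sym eq))
  ... | no  _ | yes q = inj₂ (inj₂ (eq , q))
  ... | no  _ | no  _ = inj₁ eq

  map-redirect : ∀ {xs} → r ∉ xs → map redirect xs ≡ xs
  map-redirect {[]}     r∉ = refl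
  map-redirect {x ∷ xs} r∉ =
    cong₂ _∷_ (redirect-miss (λ x≡r → r∉ (here (sym x≡r)))) (map-redirect (r∉ ∘ there))

  module _ {xs ys : List (Fin N)} (uniq : Unique (r ∷ ys)) where

    private
      r∉ys : r ∉ ys
      r∉ys = head∉tail uniq

    redirect-↭₁ : xs ↭ ys → map redirect xs ↭ ys
    redirect-↭₁ p = ↭-trans (map⁺ redirect p) (↭-reflexive (map-redirect r∉ys))

    -- Redirection fixes the `s` on the left and turns the `r` on the right into `s`, so the two
    -- cancel.
    redirect-↭₂ : s ∷ xs ↭ r ∷ ys → r ≢ s → map redirect xs ↭ ys
    redirect-↭₂ p r≢s = drop-∷ {x = s}
      (↭-trans (↭-reflexive (cong (_∷ map redirect xs) (sym (redirect-miss (r≢s ∘ sym)))))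
      (↭-trans (map⁺ redirect p)
               (↭-reflexive (cong₂ _∷_ (redirect-hit refl) (map-redirect r∉ys)))))

    -- Since `ys` has no repetitions, at most one entry of `xs` is `r` or `s`. If none is `r`,
    -- redirection changes nothing; if one is `r`, exchanging it for `s` gives `ys`. This is why an
    -- edge from a tree to another component leaves no choice of its end.
    redirect-↭⁻ : r ≢ s → map redirect xs ↭ ys →
                  (xs ↭ ys × ¬ (s ∷ xs ↭ r ∷ ys)) ⊎ (¬ (xs ↭ ys) × s ∷ xs ↭ r ∷ ys)
    redirect-↭⁻ r≢s p with DecMembership._∈?_ _≟_ r xs
    ... | no r∉xs =
      inj₁ ( ↭-trans (↭-reflexive (sym (map-redirect r∉xs))) p
           , λ q → r∉s∷xs (∈-resp-↭ (↭-sym q) (here refl)))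
      where
      r∉s∷xs : r ∉ s ∷ xs
      r∉s∷xs (here r≡s)   = r≢s r≡s
      r∉s∷xs (there r∈xs) = r∉xs r∈xs
    ... | yes r∈xs with zs , q ← ∈⇒↭∷ r∈xs =
      inj₂ ( (λ p′ → r∉ys (∈-resp-↭ p′ r∈xs))
           , ↭-trans (↭-prep s q) (↭-trans (↭-swap s r ↭-refl) (↭-prep r s∷zs↭ys)))
      where
      s∷ρzs↭ys : s ∷ map redirect zs ↭ ys
      s∷ρzs↭ys = ↭-trans (↭-reflexive (cong (_∷ map redirect zs) (sym (redirect-hit refl))))
                   (↭-trans (↭-sym (map⁺ redirect q)) p)
      r∉zs : r ∉ zs
      r∉zs r∈zs =
        head∉tail (Unique-resp-↭ (↭-sym s∷ρzs↭ys) (AllPairs.tail uniq))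
          (subst (_∈ map redirect zs) (redirect-hit refl) (∈-map⁺ redirect r∈zs))
      s∷zs↭ys : s ∷ zs ↭ ys
      s∷zs↭ys = ↭-trans (↭-reflexive (cong (s ∷_) (sym (map-redirect r∉zs)))) s∷ρzs↭ys

-- Multigraphs

module Multigraph {N m : ℕ} (a b : Fin m → Fin N) where

  V E : Set
  V = Fin N
  E = Fin m

  data Link (i : E) : V → V → Set where
    fwd : Link i (a i) (b i)
    bwd : Link i (b i) (a i)

  flip : ∀ {i u v} → Link i u v → Link i v u
  flip fwd = bwd
  flip bwd = fwd

  infixr 5 _◅ʷ_

  data Walk : V → V → Set where
    εʷ   : ∀ {u} → Walk u u
    _◅ʷ_ : ∀ {i u v w} → Link i u v → Walk v w → Walk u w

  edges : ∀ {u v} → Walk u v → List E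
  edges εʷ             = []
  edges (_◅ʷ_ {i} _ p) = i ∷ edges p

  verts : ∀ {u v} → Walk u v → List V
  verts (εʷ {u})           = u ∷ []
  verts (_◅ʷ_ {u = u} _ p) = u ∷ verts p

  bridge : ∀ {i u x y v} → Walk u x → Link i x y → Walk y v → Walk u v
  bridge εʷ       l q = l ◅ʷ q
  bridge (k ◅ʷ p) l q = k ◅ʷ bridge p l q

  edges-bridge : ∀ {i u x y v} (p : Walk u x) (l : Link i x y) (q : Walk y v) →
                 edges (bridge p l q) ≡ edges p ++ i ∷ edges q
  edges-bridge εʷ       l q = refl
  edges-bridge (k ◅ʷ p) l q = cong (_ ∷_) (edges-bridge p l q)

  verts-bridge : ∀ {i u x y v} (p : Walk u x) (l : Link i x y) (q : Walk y v) →
                 verts (bridge p l q) ≡ verts p ++ verts q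
  verts-bridge εʷ       l q = refl
  verts-bridge (k ◅ʷ p) l q = cong (_ ∷_) (verts-bridge p l q)

  -- Rewrites a walk in the vector form of `Cycle`. The closing link from `v` to `x` stays a
  -- parameter: `x = u` gives the cyclic shift of the vertices, while a general `x` lets the
  -- induction go through.
  vectors : ∀ {u v} (p : Walk u v) → ∃ λ k → ∃₂ λ (vs : Vec V k) (es : Vec E k) →
            Vec.toList (u ∷ vs) ≡ verts p × Vec.toList es ≡ edges p ×
            (∀ {i x} → Link i v x →
               ∀ j → Link (lookup (es ∷ʳ i) j) (lookup (u ∷ vs) j) (lookup (vs ∷ʳ x) j))
  vectors εʷ = zero , [] , [] , refl , refl , λ { l zero → l }
  vectors (_◅ʷ_ {i} {u} {v} l p) with k , vs , es , vs≡ , es≡ , links ← vectors p =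
    suc k , v ∷ vs , i ∷ es , cong (u ∷_) vs≡ , cong (i ∷_) es≡ ,
    λ { l′ zero → l ; l′ (suc j) → links l′ j }

  walk-along : ∀ {k u x} (vs : Vec V k) (es : Vec E (suc k)) →
               (∀ j → Link (lookup es j) (lookup (u ∷ vs) j) (lookup (vs ∷ʳ x) j)) →
               ∃ λ (p : Walk u x) → edges p ≡ Vec.toList es
  walk-along []       (e ∷ []) links = links zero ◅ʷ εʷ , refl
  walk-along (v ∷ vs) (e ∷ es) links with p , eq ← walk-along vs es (links ∘ suc) =
    links zero ◅ʷ p , cong (e ∷_) eq

  -- The class conditions keep the path within one component. `edges-class` looks at one end of each
  -- edge, which is enough to make paths in different components edge-disjoint.
  record SimplePath (es : List E) (rep : V → V) (u v : V) : Set where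
    field
      walk         : Walk u v
      verts-unique : Unique (verts walk)
      edges-unique : Unique (edges walk)
      edges⊆       : All (_∈ es) (edges walk)
      verts-class  : All (λ x → rep x ≡ rep u) (verts walk)
      edges-class  : All (λ i → rep (a i) ≡ rep u) (edges walk)

  -- A simple path closed up by one further edge `i`. Distinctness of the edges, rather than a bound
  -- on the length, excludes going back along the same edge and admits two parallel edges.
  record Circuit (rep : V → V) (r : V) : Set where
    field
      {i}          : E
      {x y}        : V
      link         : Link i x y
      walk         : Walk y x
      verts-unique : Unique (verts walk)
      edges-unique : Unique (i ∷ edges walk)
      verts-class  : All (λ z → rep z ≡ r) (verts walk)

  -- Vertices may repeat here. Trees are shown to have no closed trail at all and other components
  -- to contain a circuit, so each half of the dichotomy is kept in its stronger form.
  record ClosedTrail (es : List E) (u : V) : Set where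
    field
      walk         : Walk u u
      nonempty     : edges walk ≢ []
      edges-unique : Unique (edges walk)
      edges⊆       : All (_∈ es) (edges walk)

  closed-trail : ∀ {k u} (vs : Vec V k) (es : Vec E (suc k)) → Unique (Vec.toList es) →
                 (∀ j → Link (lookup es j) (lookup (u ∷ vs) j) (lookup (vs ∷ʳ u) j)) →
                 ClosedTrail (allFin m) u
  closed-trail vs (e ∷ es) distinct links with p , eq ← walk-along vs (e ∷ es) links = record
    { walk = p ; nonempty = λ none → contradiction (trans (sym none) eq) (λ ())
    ; edges-unique = subst Unique (sym eq) distinct ; edges⊆ = All.universal ∈-allFin _ }

  map-circuit : ∀ {rep r} (f : V → V) → Circuit rep r → Circuit (f ∘ rep) (f r)
  map-circuit f c = record
    { link = link ; walk = walk ; verts-unique = verts-unique ; edges-unique = edges-unique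
    ; verts-class = All.map (cong f) verts-class }
    where open Circuit c

  weaken-path : ∀ {es rep u v e} (f : V → V) → SimplePath es rep u v → SimplePath (e ∷ es) (f ∘ rep) u v
  weaken-path f p = record
    { walk = walk ; verts-unique = verts-unique ; edges-unique = edges-unique
    ; edges⊆ = All.map there edges⊆
    ; verts-class = All.map (cong f) verts-class ; edges-class = All.map (cong f) edges-class }
    where open SimplePath p

  -- rep sends every vertex to a representative of its component.
  record Components (es : List E) (rep : V → V) : Set where
    field
      joined    : ∀ {i} → i ∈ es → rep (a i) ≡ rep (b i)
      connected : ∀ u v → rep u ≡ rep v → SimplePath es rep u v

    link-class : ∀ {i u v} → i ∈ es → Link i u v → rep u ≡ rep v
    link-class i∈ fwd = joined i∈
    link-class i∈ bwd = sym (joined i∈)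

    walk-class : ∀ {u v} (p : Walk u v) → All (_∈ es) (edges p) → rep u ≡ rep v
    walk-class εʷ       []        = refl
    walk-class (l ◅ʷ p) (i∈ ∷ p⊆) = trans (link-class i∈ l) (walk-class p p⊆)

    -- The edges are distinct, so `e` is passed at most once, and the pieces before and after it use
    -- old edges only.
    split-at : ∀ {e u v} (p : Walk u v) → Unique (edges p) → All (_∈ e ∷ es) (edges p) →
               All (_∈ es) (edges p) ⊎ ∃₂ λ x y → Link e x y × rep u ≡ rep x × rep y ≡ rep v
    split-at εʷ _ [] = inj₁ []
    split-at (l ◅ʷ p) uniq@(_ ∷ _) (here refl ∷ p⊆) =
      inj₂ (_ , _ , l , refl , walk-class p (All.tabulate in-es))
      where
      in-es : ∀ {j} → j ∈ edges p → j ∈ es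
      in-es j∈ with All.lookup p⊆ j∈
      ... | here refl = contradiction j∈ (head∉tail uniq)
      ... | there j∈es = j∈es
    split-at (l ◅ʷ p) (_ ∷ uniq) (there i∈ ∷ p⊆) with split-at p uniq p⊆
    ... | inj₁ p⊆es = inj₁ (i∈ ∷ p⊆es)
    ... | inj₂ (x , y , k , u≈x , y≈v) = inj₂ (x , y , k , trans (link-class i∈ l) u≈x , y≈v)

    -- A closed trail through `e` connects `u` by old edges to both ends of `e`, so the conclusion
    -- holds for either orientation of `e`.
    trail-at : ∀ {e u} → ClosedTrail (e ∷ es) u →
               ClosedTrail es u ⊎ (∀ {x y} → Link e x y → rep u ≡ rep x)
    trail-at t with split-at (ClosedTrail.walk t) (ClosedTrail.edges-unique t) (ClosedTrail.edges⊆ t)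
    ... | inj₁ p⊆ = inj₁ (record { ClosedTrail t ; edges⊆ = p⊆ })
    ... | inj₂ (x , y , l , u≈x , y≈u) = inj₂ (λ k → ends l u≈x (sym y≈u) k)
      where
      ends : ∀ {e u x y x′ y′} → Link e x y → rep u ≡ rep x → rep u ≡ rep y → Link e x′ y′ → rep u ≡ rep x′
      ends fwd p q fwd = p
      ends fwd p q bwd = q
      ends bwd p q fwd = q
      ends bwd p q bwd = p

  -- Counting, and the state kept while edges are added

  open Components

  -- `F` collects the vertices already taken. Injectivity and surjectivity are tested only when the
  -- edges run out, so the recursion has two summands and no side conditions.
  count : List E → List V → ℕ
  count []       F = indicator (enumerates? F)
  count (e ∷ es) F = count es (a e ∷ F) + count es (b e ∷ F)

  count-link : ∀ {e x y} es F → Link e x y → count (e ∷ es) F ≡ count es (x ∷ F) + count es (y ∷ F)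
  count-link es F fwd = refl
  count-link {e} es F bwd = +-comm (count es (a e ∷ F)) _

  -- `T` lists the representatives of the tree components. This is kept apart from the counting
  -- because it remains valid when some component has an excess of edges.
  record Trees (es : List E) (rep : V → V) (T : List V) : Set where
    field
      unique  : Unique T
      root    : ∀ {r} → r ∈ T → rep r ≡ r
      acyclic : ∀ {u} → rep u ∈ T → ¬ ClosedTrail es u
      cyclic  : ∀ {v} → rep v ∉ T → Circuit rep (rep v)

  -- U lists the representatives of the unicyclic components.
  record Balanced (es : List E) (rep : V → V) (T U : List V) : Set where
    field
      unique : Unique (T ++ U)
      root   : ∀ {r} → r ∈ U → rep r ≡ r
      cover  : ∀ v → rep v ∈ T ++ U
      size   : length T + length es ≡ N
      count≡ : ∀ F → map rep F ↭ T → count es F ≡ 2 ^ length U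
      count⁻ : ∀ F → count es F ≢ 0 → map rep F ↭ T

    count≡0 : ∀ F → ¬ (map rep F ↭ T) → count es F ≡ 0
    count≡0 F ¬p with count es F ℕ.≟ 0
    ... | yes z = z
    ... | no ¬z = contradiction (count⁻ F ¬z) ¬p

  record Overfull (es : List E) (T : List V) : Set where
    field
      size   : N < length T + length es
      count≡0 : ∀ F → count es F ≡ 0

  record State (es : List E) : Set where
    field
      rep        : V → V
      T          : List V
      components : Components es rep
      trees      : Trees es rep T
      counting   : (∃ λ U → Balanced es rep T U) ⊎ Overfull es T

  initial : State []
  initial = record
    { rep = id ; T = allFin N
    ; components = record { joined = λ () ; connected = λ { u .u refl → record
        { walk = εʷ ; verts-unique = [] ∷ [] ; edges-unique = [] ; edges⊆ = []
        ; verts-class = refl ∷ [] ; edges-class = [] } } }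
    ; trees = record
        { unique = Uniqueₚ.allFin⁺ N ; root = λ _ → refl
        ; acyclic = λ _ t → trail-[] (ClosedTrail.walk t) (ClosedTrail.nonempty t) (ClosedTrail.edges⊆ t)
        ; cyclic = λ v∉ → contradiction (∈-allFin _) v∉ }
    ; counting = inj₁ ([] , record
        { unique = Uniqueₚ.++⁺ (Uniqueₚ.allFin⁺ N) [] (λ ())
        ; root = λ () ; cover = λ v → ∈-++⁺ˡ (∈-allFin v)
        ; size = trans (+-identityʳ _) (length-tabulate id)
        ; count≡ = count≡ ; count⁻ = count⁻ }) }
    where
    trail-[] : ∀ {u v} (p : Walk u v) → edges p ≢ [] → ¬ All (_∈ []) (edges p)
    trail-[] εʷ       ne _        = ne refl
    trail-[] (_ ◅ʷ _) _  (() ∷ _)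
    count≡ : ∀ F → map id F ↭ allFin N → count [] F ≡ 1
    count≡ F p = indicator≡1 (enumerates? F) (↭⇒enumerates (subst (_↭ _) (map-id F) p))
    count⁻ : ∀ F → count [] F ≢ 0 → map id F ↭ allFin N
    count⁻ F ne = subst (_↭ _) (sym (map-id F)) (enumerates⇒↭ (indicator≢0⇒ (enumerates? F) ne))

  -- Losing one tree pays for the new edge; when no tree is lost, the sum grows by one.
  tree-size : ∀ {r} {T T′ : List V} (es : List E) → T ↭ r ∷ T′ →
              length T + length es ≡ length T′ + suc (length es)
  tree-size es p = trans (cong (_+ length es) (↭-length p)) (sym (+-suc _ (length es)))

  shrink-overfull : ∀ {r e es T T′} → T ↭ r ∷ T′ → Overfull es T → Overfull (e ∷ es) T′
  shrink-overfull {es = es} p o = record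
    { size = subst (N <_) (tree-size es p) size
    ; count≡0 = λ F → cong₂ _+_ (count≡0 _) (count≡0 _) }
    where open Overfull o

  keep-overfull : ∀ {e es T} → Overfull es T → Overfull (e ∷ es) T
  keep-overfull {es = es} {T} o = record
    { size = subst (N <_) (sym (+-suc (length T) (length es))) (m≤n⇒m≤1+n size)
    ; count≡0 = λ F → cong₂ _+_ (count≡0 _) (count≡0 _) }
    where open Overfull o

  -- If neither end of a new edge lies in a tree, then that edge has no free end to be sent to.
  overfull : ∀ {e x y es rep T U} → Link e x y → rep x ∉ T → rep y ∉ T →
             Balanced es rep T U → Overfull (e ∷ es) T
  overfull {es = es} {rep} {T} l x∉T y∉T bal = record
    { size = subst (N <_) (sym (trans (+-suc (length T) (length es)) (cong suc size))) (s≤s ≤-refl)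
    ; count≡0 = λ F → trans (count-link es F l) (cong₂ _+_ (vanish F x∉T) (vanish F y∉T)) }
    where
    open Balanced bal
    vanish : ∀ {x} F → rep x ∉ T → count es (x ∷ F) ≡ 0
    vanish F x∉ = count≡0 _ (λ p → x∉ (∈-resp-↭ p (here refl)))

  nonzero-+ : ∀ {m n} → m + n ≢ 0 → m ≢ 0 ⊎ n ≢ 0
  nonzero-+ {zero}  ne = inj₂ ne
  nonzero-+ {suc m} ne = inj₁ (λ ())

  -- A new edge inside a component

  module Close {es e x y rep} (link : Link e x y) (e∉es : e ∉ es)
               (comps : Components es rep) (x≈y : rep x ≡ rep y) where

    components′ : Components (e ∷ es) rep
    components′ = record
      { joined    = λ { (here refl) → joined-e link x≈y ; (there i∈) → joined comps i∈ }
      ; connected = λ u v u≈v → weaken-path id (connected comps u v u≈v) }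
      where
      joined-e : ∀ {e x y} → Link e x y → rep x ≡ rep y → rep (a e) ≡ rep (b e)
      joined-e fwd p = p
      joined-e bwd p = sym p

    -- The old component already has a simple path from `y` to `x`; the new edge closes it and is
    -- not on it because of `e∉es`.
    circuit : Circuit rep (rep x)
    circuit = record
      { link = link ; walk = walk ; verts-unique = verts-unique
      ; edges-unique = Unique-∷ (λ e∈ → e∉es (All.lookup edges⊆ e∈)) edges-unique
      ; verts-class = All.map (λ p → trans p (sym x≈y)) verts-class }
      where open SimplePath (connected comps y x (sym x≈y))

    old-trail : ∀ {u} → rep u ≢ rep x → ClosedTrail (e ∷ es) u → ClosedTrail es u
    old-trail u≉x t with trail-at comps t
    ... | inj₁ t′   = t′
    ... | inj₂ ends = contradiction (ends link) u≉x

    module Tree {T T′} (T↭ : T ↭ rep x ∷ T′) (trees : Trees es rep T) where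

      open Trees trees

      unique′ : Unique (rep x ∷ T′)
      unique′ = Unique-resp-↭ T↭ unique

      ⊆T : ∀ {r} → r ∈ T′ → r ∈ T
      ⊆T = ∈-resp-↭ (↭-sym T↭) ∘ there

      trees′ : Trees (e ∷ es) rep T′
      trees′ = record
        { unique  = AllPairs.tail unique′
        ; root    = root ∘ ⊆T
        ; acyclic = λ {u} u∈ t → acyclic (⊆T u∈)
            (old-trail (λ u≈x → head∉tail unique′ (subst (_∈ T′) u≈x u∈)) t)
        ; cyclic  = cyclic′ }
        where
        cyclic′ : ∀ {v} → rep v ∉ T′ → Circuit rep (rep v)
        cyclic′ {v} v∉ with rep v ≟ rep x
        ... | yes v≈x = subst (Circuit rep) (sym v≈x) circuit
        ... | no  v≉x = cyclic (λ v∈ → case-∈ (∈-resp-↭ T↭ v∈))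
          where
          case-∈ : rep v ∉ rep x ∷ T′
          case-∈ (here v≈x) = v≉x v≈x
          case-∈ (there v∈) = v∉ v∈

      -- Both ends have the same representative, so `x ∷ F` and `y ∷ F` meet the trees alike: either
      -- both choices count `2 ^ length U` or both count 0. The tree moves from `T` to `U`, which
      -- accounts for the doubling.
      balanced′ : ∀ {U} → Balanced es rep T U → Balanced (e ∷ es) rep T′ (rep x ∷ U)
      balanced′ {U} bal = record
        { unique = Unique-resp-↭ T++U↭ B.unique
        ; root   = λ { (here refl) → root (∈-resp-↭ (↭-sym T↭) (here refl)) ; (there r∈) → B.root r∈ }
        ; cover  = λ v → ∈-resp-↭ T++U↭ (B.cover v)
        ; size   = trans (sym (tree-size es T↭)) B.size
        ; count≡ = λ F p → trans (count-link es F link)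
            (trans (cong₂ _+_ (B.count≡ _ (↭-trans (↭-prep _ p) (↭-sym T↭)))
                              (B.count≡ _ (↭-trans (↭-trans (↭-reflexive (cong (_∷ map rep F) (sym x≈y))) (↭-prep _ p)) (↭-sym T↭))))
                   -- `2 ^ suc k` computes to `2 ^ k + (2 ^ k + 0)`.
                   (cong (2 ^ length U +_) (sym (+-identityʳ _))))
        ; count⁻ = λ F ne → [ (λ ne₁ → drop-∷ (↭-trans (B.count⁻ _ ne₁) T↭))
                            , (λ ne₂ → drop-∷ (↭-trans (↭-reflexive (cong (_∷ map rep F) x≈y)) (↭-trans (B.count⁻ _ ne₂) T↭)))
                            ]′ (nonzero-+ (ne ∘ trans (count-link es F link))) }
        where
        module B = Balanced bal
        T++U↭ : T ++ U ↭ T′ ++ rep x ∷ U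
        T++U↭ = ↭-trans (++⁺ʳ U T↭) (↭-sym (shift (rep x) T′ U))

    keep-trees : ∀ {T} → rep x ∉ T → Trees es rep T → Trees (e ∷ es) rep T
    keep-trees {T} x∉ trees = record
      { unique = unique ; root = root ; cyclic = cyclic
      ; acyclic = λ u∈ t → acyclic u∈ (old-trail (λ u≈x → x∉ (subst (_∈ T) u≈x u∈)) t) }
      where open Trees trees

  -- A new edge between two components

  module Merge {es e x y rep} (link : Link e x y)
               (comps : Components es rep) (x≉y : rep x ≢ rep y) where

    open Redirect (rep x) (rep y)

    -- Only the representative of `x` disappears; hence `x` is taken on the side of a tree whenever
    -- there is one.
    rep′ : V → V
    rep′ = redirect ∘ rep

    rep′-x : ∀ {v} → rep v ≡ rep x → rep′ v ≡ rep y
    rep′-x = redirect-hit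

    rep′-y : rep′ y ≡ rep y
    rep′-y = redirect-miss (x≉y ∘ sym)

    -- A path to `x`, then `e`, then a path from `y`: the halves lie in different old components, so
    -- they share neither vertices nor edges. The ends are quantified afresh so that `e` can be
    -- crossed in either direction.
    bridge-path : ∀ {x y u v} → Link e x y → rep x ≢ rep y → rep′ x ≡ rep′ y →
                  rep u ≡ rep x → rep y ≡ rep v → SimplePath (e ∷ es) rep′ u v
    bridge-path {x} {y} {u} {v} l x≉y x≈′y u≈x y≈v = record
      { walk = bridge P.walk l Q.walk
      ; verts-unique = subst Unique (sym (verts-bridge P.walk l Q.walk))
          (Uniqueₚ.++⁺ P.verts-unique Q.verts-unique
            (λ (p , q) → apart (All.lookup P.verts-class p) (All.lookup Q.verts-class q)))
      ; edges-unique = subst Unique (sym (edges-bridge P.walk l Q.walk))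
          (Uniqueₚ.++⁺ P.edges-unique
            (Unique-∷ (λ q → not-e (All.lookup Q.edges⊆ q)) Q.edges-unique)
            (λ { (p , here refl) → not-e (All.lookup P.edges⊆ p)
               ; (p , there q) → apart (All.lookup P.edges-class p) (All.lookup Q.edges-class q) }))
      ; edges⊆ = subst (All _) (sym (edges-bridge P.walk l Q.walk))
          (Allₚ.++⁺ (All.map there P.edges⊆) (here refl ∷ All.map there Q.edges⊆))
      ; verts-class = subst (All _) (sym (verts-bridge P.walk l Q.walk))
          (Allₚ.++⁺ (All.map (cong redirect) P.verts-class)
                    (All.map (λ q → trans (cong redirect q) y≈′u) Q.verts-class))
      ; edges-class = subst (All _) (sym (edges-bridge P.walk l Q.walk))
          (Allₚ.++⁺ (All.map (cong redirect) P.edges-class)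
                    (e-class l x≈′y (sym y≈′u) ∷ All.map (λ q → trans (cong redirect q) y≈′u) Q.edges-class)) }
      where
      module P = SimplePath (connected comps u x u≈x)
      module Q = SimplePath (connected comps y v y≈v)
      y≈′u : rep′ y ≡ rep′ u
      y≈′u = trans (sym x≈′y) (cong redirect (sym u≈x))
      apart : ∀ {z} → rep z ≡ rep u → rep z ≡ rep y → ⊥
      apart p q = x≉y (trans (sym u≈x) (trans (sym p) q))
      not-e : e ∉ es
      not-e e∈ = x≉y (link-class comps e∈ l)
      e-class : ∀ {x y} → Link e x y → rep′ x ≡ rep′ y → rep′ u ≡ rep′ y → rep′ (a e) ≡ rep′ u
      e-class fwd p q = trans p (sym q)
      e-class bwd p q = sym q

    components′ : Components (e ∷ es) rep′
    components′ = record
      { joined    = λ { (here refl) → joined-e link x≈′y ; (there i∈) → cong redirect (joined comps i∈) }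
      ; connected = connected′ }
      where
      x≈′y : rep′ x ≡ rep′ y
      x≈′y = trans (rep′-x refl) (sym rep′-y)
      joined-e : ∀ {e x y} → Link e x y → rep′ x ≡ rep′ y → rep′ (a e) ≡ rep′ (b e)
      joined-e fwd p = p
      joined-e bwd p = sym p
      connected′ : ∀ u v → rep′ u ≡ rep′ v → SimplePath (e ∷ es) rep′ u v
      connected′ u v eq with redirect-≡ eq
      ... | inj₁ u≈v = weaken-path redirect (connected comps u v u≈v)
      ... | inj₂ (inj₁ (u≈x , v≈y)) = bridge-path link x≉y x≈′y u≈x (sym v≈y)
      ... | inj₂ (inj₂ (u≈y , v≈x)) = bridge-path (flip link) (x≉y ∘ sym) (sym x≈′y) u≈y (sym v≈x)

    -- The new edge is a bridge: a closed trail through it would put both its ends in one old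
    -- component.
    old-trail : ∀ {u} → ClosedTrail (e ∷ es) u → ClosedTrail es u
    old-trail t with trail-at comps t
    ... | inj₁ t′   = t′
    ... | inj₂ ends = contradiction (trans (sym (ends link)) (ends (flip link))) x≉y

    keep-root : ∀ {r} → rep r ≡ r → r ≢ rep x → rep′ r ≡ r
    keep-root p r≢ = trans (redirect-miss (r≢ ∘ trans (sym p))) p

    -- Here the component of `x` is a tree. The merged component is a tree exactly if that of `y`
    -- was one, and `rep y` then already belongs to `T′`.
    module Tree {T T′} (T↭ : T ↭ rep x ∷ T′) (trees : Trees es rep T) where

      open Trees trees

      unique′ : Unique (rep x ∷ T′)
      unique′ = Unique-resp-↭ T↭ unique

      ⊆T : ∀ {r} → r ∈ T′ → r ∈ T
      ⊆T = ∈-resp-↭ (↭-sym T↭) ∘ there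

      shrink : ∀ {r} → r ∈ T → r ≢ rep x → r ∈ T′
      shrink r∈ r≢ with ∈-resp-↭ T↭ r∈
      ... | here r≡  = contradiction r≡ r≢
      ... | there r∈ = r∈

      trees′ : Trees (e ∷ es) rep′ T′
      trees′ = record
        { unique  = AllPairs.tail unique′
        ; root    = λ r∈ → keep-root (root (⊆T r∈)) (λ { refl → head∉tail unique′ r∈ })
        ; acyclic = λ {u} u∈ t → acyclic (old-tree u u∈) (old-trail t)
        ; cyclic  = cyclic′ }
        where
        old-tree : ∀ u → rep′ u ∈ T′ → rep u ∈ T
        old-tree u u∈ with rep u ≟ rep x
        ... | yes u≈x = subst (_∈ T) (sym u≈x) (∈-resp-↭ (↭-sym T↭) (here refl))
        ... | no  _   = ⊆T u∈
        cyclic′ : ∀ {v} → rep′ v ∉ T′ → Circuit rep′ (rep′ v)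
        cyclic′ {v} v∉ = by-cases (DecMembership._∈?_ _≟_ (rep v) T) (rep v ≟ rep x)
          where
          by-cases : Dec (rep v ∈ T) → Dec (rep v ≡ rep x) → Circuit rep′ (rep′ v)
          by-cases (no  v∉T) _ = map-circuit redirect (cyclic v∉T)
          by-cases (yes v∈T) (no  v≉x) =
            contradiction (subst (_∈ T′) (sym (redirect-miss v≉x)) (shrink v∈T v≉x)) v∉
          -- The class of `v` was the tree absorbed by the class of `y`. The merged class is not
          -- listed in `T′`, so `y` was in no tree and brings the circuit.
          by-cases (yes v∈T) (yes v≈x) = subst (Circuit rep′) (trans rep′-y (sym (rep′-x v≈x)))
            (map-circuit redirect (cyclic {y} λ y∈T →
              v∉ (subst (_∈ T′) (sym (rep′-x v≈x)) (shrink y∈T (x≉y ∘ sym)))))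

      -- If `F` represents the trees after merging, exactly one of `x ∷ F` and `y ∷ F` represents
      -- the old ones: the edge must go to the one old tree that `F` misses. So the count does not
      -- change.
      balanced′ : ∀ {U} → Balanced es rep T U → Balanced (e ∷ es) rep′ T′ U
      balanced′ {U} bal = record
        { unique = AllPairs.tail unique″
        ; root   = λ r∈ → keep-root (B.root r∈) (λ { refl → head∉tail unique″ (∈-++⁺ʳ T′ r∈) })
        ; cover  = cover′
        ; size   = trans (sym (tree-size es T↭)) B.size
        ; count≡ = λ F p → trans (count-link es F link)
                     (count≡′ F (redirect-↭⁻ unique′ x≉y (subst (_↭ T′) (map-∘ F) p)))
        ; count⁻ = λ F ne → subst (_↭ T′) (sym (map-∘ F))
            ([ (λ ne₁ → redirect-↭₁ unique′ (drop-∷ (↭-trans (B.count⁻ _ ne₁) T↭)))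
             , (λ ne₂ → redirect-↭₂ unique′ (↭-trans (B.count⁻ _ ne₂) T↭) x≉y)
             ]′ (nonzero-+ (ne ∘ trans (count-link es F link)))) }
        where
        module B = Balanced bal
        unique″ : Unique (rep x ∷ T′ ++ U)
        unique″ = Unique-resp-↭ (++⁺ʳ U T↭) B.unique
        shrink′ : ∀ v → rep v ≢ rep x → rep v ∈ T′ ++ U
        shrink′ v v≉x with ∈-resp-↭ (++⁺ʳ U T↭) (B.cover v)
        ... | here v≈x = contradiction v≈x v≉x
        ... | there v∈ = v∈
        cover′ : ∀ v → rep′ v ∈ T′ ++ U
        cover′ v with rep v ≟ rep x
        ... | yes _   = shrink′ y (x≉y ∘ sym)
        ... | no  v≉x = shrink′ v v≉x
        count≡′ : ∀ F → (map rep F ↭ T′ × ¬ (rep y ∷ map rep F ↭ rep x ∷ T′))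
                      ⊎ (¬ (map rep F ↭ T′) × rep y ∷ map rep F ↭ rep x ∷ T′) →
                  count es (x ∷ F) + count es (y ∷ F) ≡ 2 ^ length U
        count≡′ F (inj₁ (p , ¬q)) =
          trans (cong₂ _+_ (B.count≡ (x ∷ F) (↭-trans (↭-prep _ p) (↭-sym T↭)))
                           (B.count≡0 (y ∷ F) (λ q → ¬q (↭-trans q T↭))))
                (+-identityʳ _)
        count≡′ F (inj₂ (¬p , q)) =
          cong₂ _+_ (B.count≡0 (x ∷ F) (λ p → ¬p (drop-∷ (↭-trans p T↭))))
                    (B.count≡ (y ∷ F) (↭-trans q (↭-sym T↭)))

    keep-trees : ∀ {T} → rep x ∉ T → rep y ∉ T → Trees es rep T → Trees (e ∷ es) rep′ T
    keep-trees {T} x∉ y∉ trees = record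
      { unique  = unique
      ; root    = λ r∈ → keep-root (root r∈) (λ { refl → x∉ r∈ })
      ; acyclic = λ {u} u∈ t → acyclic (old-tree u u∈) (old-trail t)
      ; cyclic  = λ {v} v∉ → map-circuit redirect (cyclic (v∉ ∘ kept v)) }
      where
      open Trees trees
      old-tree : ∀ u → rep′ u ∈ T → rep u ∈ T
      old-tree u u∈ with rep u ≟ rep x
      ... | yes _ = contradiction u∈ y∉
      ... | no  _ = u∈
      kept : ∀ v → rep v ∈ T → rep′ v ∈ T
      kept v v∈ = subst (_∈ T) (sym (redirect-miss (λ v≈x → x∉ (subst (_∈ T) v≈x v∈)))) v∈

  -- Two questions decide the case: whether the ends share a component and whether a tree is
  -- touched. Touching a tree uses it up and leaves the state balanced or overfull as it was;
  -- touching none ends in `Overfull`.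
  add-edge : ∀ {e es} → e ∉ es → State es → State (e ∷ es)
  add-edge {e} {es} e∉es st = by-cases (rep (a e) ≟ rep (b e)) (rep (a e) ∈? T) (rep (b e) ∈? T)
    where
    open State st
    open DecMembership _≟_ using (_∈?_)

    merge-tree : ∀ {x y} → Link e x y → rep x ≢ rep y → rep x ∈ T → State (e ∷ es)
    merge-tree link x≉y x∈ with T′ , T↭ ← ∈⇒↭∷ x∈ = record
      { components = M.components′ ; trees = M.Tree.trees′ T↭ trees
      ; counting = [ (λ (U , bal) → inj₁ (U , M.Tree.balanced′ T↭ trees bal)) , inj₂ ∘ shrink-overfull T↭ ]′ counting }
      where module M = Merge link components x≉y

    by-cases : Dec (rep (a e) ≡ rep (b e)) → Dec (rep (a e) ∈ T) → Dec (rep (b e) ∈ T) → State (e ∷ es)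
    by-cases (yes a≈b) (yes a∈) _ with T′ , T↭ ← ∈⇒↭∷ a∈ = record
      { components = C.components′ ; trees = C.Tree.trees′ T↭ trees
      ; counting = [ (λ (U , bal) → inj₁ (_ , C.Tree.balanced′ T↭ trees bal)) , inj₂ ∘ shrink-overfull T↭ ]′ counting }
      where module C = Close fwd e∉es components a≈b
    by-cases (yes a≈b) (no a∉) _ = record
      { components = C.components′ ; trees = C.keep-trees a∉ trees
      ; counting = inj₂ ([ (λ (U , bal) → overfull fwd a∉ (subst (_∉ T) a≈b a∉) bal) , keep-overfull ]′ counting) }
      where module C = Close fwd e∉es components a≈b
    by-cases (no a≉b) (yes a∈) _        = merge-tree fwd a≉b a∈
    -- The edge is reversed, since the tree to be absorbed must be at its first end.
    by-cases (no a≉b) (no a∉)  (yes b∈) = merge-tree bwd (a≉b ∘ sym) b∈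
    by-cases (no a≉b) (no a∉)  (no b∉)  = record
      { components = M.components′ ; trees = M.keep-trees a∉ b∉ trees
      ; counting = inj₂ ([ (λ (U , bal) → overfull fwd a∉ b∉ bal) , keep-overfull ]′ counting) }
      where module M = Merge fwd components a≉b

  state : ∀ {es} → Unique es → State es
  state {[]}     []             = initial
  state {e ∷ es} uniq@(_ ∷ u) = add-edge (head∉tail uniq) (state u)

-- Counting placements

length-filter-++ : {A : Set} {P : A → Set} (P? : Decidable P) (xs ys : List A) →
                   length (filter P? (xs ++ ys)) ≡ length (filter P? xs) + length (filter P? ys)
length-filter-++ P? xs ys = trans (cong length (filter-++ P? xs ys)) (length-++ (filter P? xs))

length-filter-map : {A B : Set} {P : B → Set} (P? : Decidable P) (f : A → B) (xs : List A) →
                    length (filter P? (map f xs)) ≡ length (filter (P? ∘ f) xs)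
length-filter-map P? f []       = refl
length-filter-map P? f (x ∷ xs) with P? (f x)
... | yes _ = cong suc (length-filter-map P? f xs)
... | no  _ = length-filter-map P? f xs

length-filter-concatMap : {A B : Set} {P : B → Set} (P? : Decidable P) (f : A → List B) (xs : List A) →
                          length (filter P? (concatMap f xs)) ≡ sum (map (λ x → length (filter P? (f x))) xs)
length-filter-concatMap P? f []       = refl
length-filter-concatMap P? f (x ∷ xs) =
  trans (length-filter-++ P? (f x) (concatMap f xs))
        (cong (length (filter P? (f x)) +_) (length-filter-concatMap P? f xs))

length-filter-[_] : {A : Set} {P : A → Set} {Q : Set} {P? : Decidable P} (Q? : Dec Q) {x : A} →
                    P x ⇔ Q → length (filter P? [ x ]) ≡ indicator Q?
length-filter-[_] {P? = P?} Q? {x} eq with P? x | Q?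
... | yes _ | yes _ = refl
... | no  _ | no  _ = refl
... | yes p | no ¬q = contradiction (Equivalence.to eq p) ¬q
... | no ¬p | yes q = contradiction (Equivalence.from eq q) ¬p

sum-zero : {A : Set} (h : A → ℕ) (xs : List A) → (∀ {x} → x ∈ xs → h x ≡ 0) → sum (map h xs) ≡ 0
sum-zero h []       z = refl
sum-zero h (x ∷ xs) z = cong₂ _+_ (z (here refl)) (sum-zero h xs (z ∘ there))

-- An edge has only two possible images, so a sum over all vertices collapses to the two summands of
-- `count`. Both points are brought to the front by a permutation of `allFin n`.
sum-two-points : ∀ {n} (h : Fin n → ℕ) {x y} → x ≢ y → (∀ z → z ≢ x → z ≢ y → h z ≡ 0) →
                 sum (map h (allFin n)) ≡ h x + h y
sum-two-points {n} h {x} {y} x≢y zero-off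
  with ys , p ← ∈⇒↭∷ (∈-allFin x) with ∈-resp-↭ p (∈-allFin y)
... | here y≡x = contradiction (sym y≡x) x≢y
... | there y∈ with zs , q ← ∈⇒↭∷ y∈ =
  trans (sum-↭ (map⁺ h perm))
    (cong (h x +_) (trans (cong (h y +_) (sum-zero h zs off)) (+-identityʳ _)))
  where
  perm : allFin n ↭ x ∷ y ∷ zs
  perm = ↭-trans p (↭-prep x q)
  uniq : Unique (x ∷ y ∷ zs)
  uniq = Unique-resp-↭ perm (Uniqueₚ.allFin⁺ n)
  off : ∀ {z} → z ∈ zs → h z ≡ 0
  off z∈ = zero-off _ (λ { refl → head∉tail uniq (there z∈) })
                      (λ { refl → head∉tail (AllPairs.tail uniq) z∈ })

-- solutionNumber can only be unfolded by a conversion check, which evaluates it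
-- up to the first vector without repetitions, (0, 1, …, 7).  Stating the unfolded
-- form with the part of allVecs 8 that starts there spares a second such
-- evaluation, provided that the remaining list has literally the shape that
-- evaluating allVecs leaves behind: hence foldr _++_ [] and not concat.

block : ∀ {k} → ℕ → List (Fin 8) → List (Vec (Fin 8) k) → List (Vec (Fin 8) (suc k))
block     _       []       _  = []
block {k} zero    (x ∷ xs) σs = map (x ∷_) σs ++ foldr _++_ [] (map (λ y → map (y ∷_) (allVecs k)) xs)
block     (suc i) (_ ∷ xs) σs = block i xs σs

-- The part of allVecs k from (i, i + 1, …) on.
allVecsFrom : ∀ k → ℕ → List (Vec (Fin 8) k)
allVecsFrom zero    i = [] ∷ []
allVecsFrom (suc k) i = block i (Vec.toList (Vec.allFin 8)) (allVecsFrom k (suc i))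

solutionNumber-def : ∀ W → solutionNumber W ≡ length (filter (isSolution? W) (allVecsFrom 8 0))
solutionNumber-def W = refl

-- Heads among the first `i` are rejected by `P?`, the head at position `i` has its tails replaced
-- by `σs` at equal count, and later heads agree literally. The condition on `x` singles out the
-- head at position `i` without looking it up.
length-filter-block : ∀ {k} {P : Vec (Fin 8) (suc k) → Set} (P? : Decidable P) i xs σs →
  (∀ {y} → y ∈ take i xs → ∀ σ → ¬ P (y ∷ σ)) →
  (∀ x → (∀ {y} → y ∈ take (suc i) xs → y ∈ take i xs ⊎ y ≡ x) →
     length (filter (P? ∘ (x ∷_)) σs) ≡ length (filter (P? ∘ (x ∷_)) (allVecs k))) →
  length (filter P? (block i xs σs)) ≡ length (filter P? (concatMap (λ x → map (x ∷_) (allVecs k)) xs))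
length-filter-block P? zero    []       σs _ _ = refl
length-filter-block P? (suc i) []       σs _ _ = refl
length-filter-block {k} P? zero (x ∷ xs) σs _ at-x =
  trans (length-filter-++ P? (map (x ∷_) σs) _)
  (trans (cong (_+ _) (trans (length-filter-map P? (x ∷_) σs)
           (trans (at-x x λ { (here p) → inj₂ p }) (sym (length-filter-map P? (x ∷_) (allVecs k))))))
         (sym (length-filter-++ P? (map (x ∷_) (allVecs k)) _)))
length-filter-block {k} P? (suc i) (x ∷ xs) σs skip at-x =
  trans (length-filter-block P? i xs σs (skip ∘ there) (λ z last → at-x z (shift-last last)))
        (sym (trans (length-filter-++ P? (map (x ∷_) (allVecs k)) _) (cong (_+ _) none)))
  where
  none : length (filter P? (map (x ∷_) (allVecs k))) ≡ 0
  none = trans (length-filter-map P? (x ∷_) (allVecs k))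
    (cong length (filter-none (P? ∘ (x ∷_)) (All.universal (skip (here refl)) (allVecs k))))
  shift-last : ∀ {z} → (∀ {y} → y ∈ take (suc i) xs → y ∈ take i xs ⊎ y ≡ z) →
               ∀ {y} → y ∈ x ∷ take (suc i) xs → y ∈ x ∷ take i xs ⊎ y ≡ z
  shift-last last (here p)   = inj₁ (here p)
  shift-last last (there y∈) = Sum.map₁ there (last y∈)

-- `ys` holds the entries chosen before, among them the first `i` elements. A vector left out
-- continues with an entry chosen before it, hence has a repetition and fails `P`.
length-filter-allVecsFrom : ∀ k i {P : Vec (Fin 8) k → Set} (P? : Decidable P) (ys : List (Fin 8)) →
  (∀ {y} → y ∈ take i (allFin 8) → y ∈ ys) → (∀ {σ} → P σ → Unique (ys ++ Vec.toList σ)) →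
  length (filter P? (allVecsFrom k i)) ≡ length (filter P? (allVecs k))
length-filter-allVecsFrom zero    i P? ys used uniq = refl
length-filter-allVecsFrom (suc k) i {P} P? ys used uniq =
  length-filter-block P? i (allFin 8) (allVecsFrom k (suc i))
    (λ y∈ σ p → head∉tail (uniq′ p) (∈-++⁺ˡ (used y∈)))
    (λ x last → length-filter-allVecsFrom k (suc i) (P? ∘ (x ∷_)) (x ∷ ys)
       (λ y∈ → [ there ∘ used , here ]′ (last y∈)) uniq′)
  where
  uniq′ : ∀ {x σ} → P (x ∷ σ) → Unique (x ∷ ys ++ Vec.toList σ)
  uniq′ {x} {σ} p = Unique-resp-↭ (shift x ys (Vec.toList σ)) (uniq p)

module Placements {m : ℕ} (a b : Fin m → Fin 8) (a≢b : ∀ i → a i ≢ b i) where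

  open Multigraph a b

  IsEnd : E → V → Set
  IsEnd i x = x ≡ a i ⊎ x ≡ b i

  Placement : ∀ {k} → (Fin k → E) → List V → Vec V k → Set
  Placement f F σ = Enumerates (Vec.toList σ ++ F) × (∀ i → IsEnd (f i) (lookup σ i))

  placement? : ∀ {k} (f : Fin k → E) F → Decidable (Placement f F)
  placement? f F σ = enumerates? (Vec.toList σ ++ F)
                     ×-dec all? (λ i → (lookup σ i ≟ a (f i)) ⊎-dec (lookup σ i ≟ b (f i)))

  -- Sorting placements by their first entry gives the recursion of `count`: only the two ends of
  -- the first edge contribute, and the chosen entry moves from the vector to `F` by a permutation.
  count-placements : ∀ k (f : Fin k → E) F → length (filter (placement? f F) (allVecs k)) ≡ count (tabulate f) F
  count-placements zero    f F = length-filter-[_] {P? = placement? f F} (enumerates? F) (mk⇔ proj₁ (λ en → en , λ ()))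
  count-placements (suc k) f F =
    trans (length-filter-concatMap P? (λ x → map (x ∷_) (allVecs k)) (allFin 8))
    (trans (sum-two-points h (a≢b (f zero)) zero-off)
           (cong₂ _+_ (at-end (inj₁ refl)) (at-end (inj₂ refl))))
    where
    P? = placement? f F
    h : V → ℕ
    h x = length (filter P? (map (x ∷_) (allVecs k)))
    move : ∀ x (σ : Vec V k) → x ∷ Vec.toList σ ++ F ↭ Vec.toList σ ++ x ∷ F
    move x σ = ↭-sym (shift x (Vec.toList σ) F)
    at-end : ∀ {x} → IsEnd (f zero) x → h x ≡ count (tabulate (f ∘ suc)) (x ∷ F)
    at-end {x} end = trans (length-filter-map P? (x ∷_) (allVecs k))
      (trans (cong length (filter-≐ (P? ∘ (x ∷_)) (placement? (f ∘ suc) (x ∷ F))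
                ( (λ {σ} (en , ends) → enumerates-resp-↭ (move x σ) en , ends ∘ suc)
                , (λ {σ} (en , ends) → enumerates-resp-↭ (↭-sym (move x σ)) en
                                     , λ { zero → end ; (suc i) → ends i }))
                (allVecs k)))
             (count-placements k (f ∘ suc) (x ∷ F)))
    zero-off : ∀ x → x ≢ a (f zero) → x ≢ b (f zero) → h x ≡ 0
    zero-off x x≢a x≢b = trans (length-filter-map P? (x ∷_) (allVecs k))
      (cong length (filter-none (P? ∘ (x ∷_))
        (All.universal (λ σ (_ , ends) → [ x≢a , x≢b ]′ (ends zero)) (allVecs k))))

  -- The number comes as a variable `n` with an equation, so the whole chain is stated for abstract
  -- data and not for a concrete count. A solution has no repetitions, which permits dropping the
  -- early vectors.
  placements-counted : ∀ {k} (f : Fin k → E) (P : Vec (Fin 8) k → Set) (P? : Decidable P) → P ≐ Placement f [] →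
                 ∀ n → n ≡ length (filter P? (allVecsFrom k 0)) → n ≡ count (tabulate f) []
  placements-counted {k} f P P? P≐ n eq =
    trans eq (trans (length-filter-allVecsFrom k 0 P? [] (λ ()) unique)
             (trans (cong length (filter-≐ P? (placement? f []) P≐ (allVecs k))) (count-placements k f [])))
    where
    unique : ∀ {σ} → P σ → Unique (Vec.toList σ)
    unique p = proj₁ (enumerates-resp-↭ (++-identityʳ _) (proj₁ (proj₁ P≐ p)))

-- The graph of a family of cubes

two-points : ∀ {n} {P : Fin n → Set} (P? : Decidable P) → length (filter P? (allFin n)) ≡ 2 →
             ∃₂ λ x y → x ≢ y × (∀ v → P v ⇔ (v ≡ x ⊎ v ≡ y))
two-points {n} {P} P? = from-list (filter P? (allFin n)) refl
  where
  from-list : ∀ xs → filter P? (allFin n) ≡ xs → length xs ≡ 2 →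
              ∃₂ λ x y → x ≢ y × (∀ v → P v ⇔ (v ≡ x ⊎ v ≡ y))
  from-list (x ∷ y ∷ []) eq _ =
    x , y , All.head (AllPairs.head (subst Unique eq (Uniqueₚ.filter⁺ P? (Uniqueₚ.allFin⁺ n)))) ,
    λ v → mk⇔ (λ pv → two-cases (subst (v ∈_) eq (∈-filter⁺ P? (∈-allFin v) pv)))
              (λ p → proj₂ (∈-filter⁻ P? {xs = allFin n} (subst (v ∈_) (sym eq) (one-of p))))
    where
    two-cases : ∀ {v} → v ∈ x ∷ y ∷ [] → v ≡ x ⊎ v ≡ y
    two-cases (here p)         = inj₁ p
    two-cases (there (here p)) = inj₂ p
    one-of : ∀ {v} → v ≡ x ⊎ v ≡ y → v ∈ x ∷ y ∷ []
    one-of = [ here , there ∘ here ]′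

-- Passes from corner numbers to their indices; `Vec.toList BaCorners` computes to
-- `map BaCorner (allFin 8)`.
two-corners : {P : ℕ → Set} (P? : Decidable P) → length (filter P? (Vec.toList BaCorners)) ≡ 2 →
              ∃₂ λ x y → x ≢ y × (∀ v → P (BaCorner v) ⇔ (v ≡ x ⊎ v ≡ y))
two-corners P? two =
  two-points (P? ∘ BaCorner) (trans (sym (length-filter-map P? BaCorner (allFin 8))) two)

ends : ∀ c → IsEdge c → ∃₂ λ x y → x ≢ y × (∀ v → BaCorner v ∈ corners c ⇔ (v ≡ x ⊎ v ≡ y))
ends c = two-corners (λ k → DecMembership._∈?_ ℕ._≟_ k (corners c))

length-filter≡⇒All : {A : Set} {P : A → Set} (P? : Decidable P) (xs : List A) →
                     length (filter P? xs) ≡ length xs → ∀ {x} → x ∈ xs → P x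
length-filter≡⇒All P? xs eq {x} x∈ with P? x
... | yes p = p
... | no ¬p = contradiction (filter-notAll P? xs (lose x∈ ¬p)) (<-irrefl eq)

all-edges : ∀ W → numEdges W ≡ 8 → ∀ i → IsEdge (W i)
all-edges W eight i =
  length-filter≡⇒All (λ j → shared (W j) ℕ.≟ 2) (allFin 8) eight (∈-allFin i)

module Cubes (W : Family) (isEdge : ∀ i → IsEdge (W i)) (a b : Fin 8 → Fin 8) (a≢b : ∀ i → a i ≢ b i)
             (corner⇔end : ∀ i v → BaCorner v ∈ corners (W i) ⇔ (v ≡ a i ⊎ v ≡ b i)) where

  open Multigraph a b public
  open Placements a b a≢b

  ends⇒link : ∀ {i u v} → u ≢ v → IsEnd i u → IsEnd i v → Link i u v
  ends⇒link u≢v (inj₁ refl) (inj₁ refl) = contradiction refl u≢v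
  ends⇒link u≢v (inj₁ refl) (inj₂ refl) = fwd
  ends⇒link u≢v (inj₂ refl) (inj₁ refl) = bwd
  ends⇒link u≢v (inj₂ refl) (inj₂ refl) = contradiction refl u≢v

  joins⇒link : ∀ {i u v} → Joins W i u v → Link i u v
  joins⇒link {i} {u} {v} (_ , u≢v , u∈ , v∈) =
    ends⇒link u≢v (Equivalence.to (corner⇔end i u) u∈) (Equivalence.to (corner⇔end i v) v∈)

  link⇒joins : ∀ {i u v} → Link i u v → Joins W i u v
  link⇒joins {i} fwd = isEdge i , a≢b i
    , Equivalence.from (corner⇔end i _) (inj₁ refl) , Equivalence.from (corner⇔end i _) (inj₂ refl)
  link⇒joins {i} bwd = isEdge i , a≢b i ∘ sym
    , Equivalence.from (corner⇔end i _) (inj₂ refl) , Equivalence.from (corner⇔end i _) (inj₁ refl)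

  solution≐placement : IsSolution W ≐ Placement id []
  solution≐placement =
      (λ {σ} ((u , c) , s) → enumerates-resp-↭ (↭-sym (++-identityʳ _)) (u , ∈-toList⁺ ∘ c)
                           , λ i → Equivalence.to (corner⇔end i _) (s i))
    , (λ {σ} (en , s) → let u , c = enumerates-resp-↭ (++-identityʳ (Vec.toList σ)) en in
                        (u , ∈-toList⁻ ∘ c) , λ i → Equivalence.from (corner⇔end i _) (s i))

  solutionNumber≡count : solutionNumber W ≡ count (tabulate id) []
  solutionNumber≡count =
    placements-counted id (IsSolution W) (isSolution? W) solution≐placement (solutionNumber W) (solutionNumber-def W)

  walk⇒reachable : ∀ {u v} → Walk u v → Reachable W u v
  walk⇒reachable εʷ       = ε
  walk⇒reachable (l ◅ʷ p) = (_ , link⇒joins l) ◅ walk⇒reachable p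

  reachable⇒class : ∀ {rep u v} → Components (allFin 8) rep → Reachable W u v → rep u ≡ rep v
  reachable⇒class comps ε             = refl
  reachable⇒class comps ((i , j) ◅ p) =
    trans (Components.link-class comps (∈-allFin i) (joins⇒link j)) (reachable⇒class comps p)

  -- Writing Fin 8 for V keeps the types syntactically equal to those in Cycle;
  -- otherwise comparing them evaluates corners and shared.
  links⇒joins : ∀ {k} (es : Vec (Fin 8) k) (us vs : Vec (Fin 8) k) →
                (∀ j → Link (lookup es j) (lookup us j) (lookup vs j)) →
                ∀ j → Joins W (lookup es j) (lookup us j) (lookup vs j)
  links⇒joins es us vs links j = link⇒joins (links j)

  joins⇒links : ∀ {k} (es : Vec (Fin 8) k) (us vs : Vec (Fin 8) k) →
                (∀ j → Joins W (lookup es j) (lookup us j) (lookup vs j)) →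
                ∀ j → Link (lookup es j) (lookup us j) (lookup vs j)
  joins⇒links es us vs joins j = joins⇒link (joins j)

  links⇒cycle : ∀ {k u} (vs : Vec (Fin 8) k) (es : Vec (Fin 8) (suc k)) →
                Unique (Vec.toList (u ∷ vs)) → Unique (Vec.toList es) →
                (∀ j → Link (lookup es j) (lookup (u ∷ vs) j) (lookup (vs ∷ʳ u) j)) → Cycle W
  links⇒cycle {k} {u} vs es vs! es! links = record
    { len = k ; verts = u ∷ vs ; edges = es ; vertsDistinct = vs! ; edgesDistinct = es!
    ; joins = links⇒joins es (u ∷ vs) (rotL (u ∷ vs)) links }

  circuit⇒cycle : ∀ {rep r} → Circuit rep r → ∃ λ (cyc : Cycle W) → ∀ j → rep (lookup (Cycle.verts cyc) j) ≡ r
  circuit⇒cycle {rep} {r} c = let k , vs , es , vs≡ , es≡ , links = vectors walk in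
    links⇒cycle vs (es ∷ʳ i)
      (subst Unique (sym vs≡) verts-unique)
      (subst Unique (sym (trans (toList-∷ʳ i es) (cong (_++ [ i ]) es≡)))
        -- The closing edge comes first in `Circuit` but last in `Cycle`.
        (Unique-resp-↭ (∷↭∷ʳ i (edges walk)) edges-unique))
      (links link)
    , λ j → All.lookup (subst (All (λ z → rep z ≡ r)) (sym vs≡) verts-class) (∈-toList⁺ (∈-lookup j (y ∷ vs)))
    where open Circuit c

  cycle⇒trail : (cyc : Cycle W) → ClosedTrail (allFin 8) (lookup (Cycle.verts cyc) zero)
  cycle⇒trail record { verts = v ∷ vs ; edges = es ; edgesDistinct = distinct ; joins = joins } =
    closed-trail vs es distinct (joins⇒links es (v ∷ vs) (rotL (v ∷ vs)) joins)

  -- Component labels and representatives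

  module _ {n : ℕ} {comp : Fin 8 → Fin n} (labelling : IsComponentLabelling W n comp)
           {rep : V → V} (comps : Components (allFin 8) rep) where

    class⇒label : ∀ {u v} → rep u ≡ rep v → comp u ≡ comp v
    class⇒label {u} {v} eq = proj₂ (proj₁ labelling u v)
      (walk⇒reachable (SimplePath.walk (Components.connected comps u v eq)))

    label⇒class : ∀ {u v} → comp u ≡ comp v → rep u ≡ rep v
    label⇒class {u} {v} eq = reachable⇒class comps (proj₁ (proj₁ labelling u v) eq)

    -- `comp` restricted to `R` is a bijection onto `Fin n`: distinct fixed points of `rep` lie in
    -- distinct classes, and every vertex `v` has the label of `rep v`.
    number-of-classes : ∀ {R} → Unique R → (∀ {r} → r ∈ R → rep r ≡ r) → (∀ v → rep v ∈ R) → length R ≡ n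
    number-of-classes {R} uniq root cover =
      trans (sym (length-map comp R)) (trans (↭-length (enumerates⇒↭ (labels-unique uniq root , complete))) (length-tabulate id))
      where
      labels-unique : ∀ {R} → Unique R → (∀ {r} → r ∈ R → rep r ≡ r) → Unique (map comp R)
      labels-unique []          root = []
      labels-unique u@(_ ∷ u′) root = Unique-∷ fresh (labels-unique u′ (root ∘ there))
        where
        fresh : comp _ ∉ map comp _
        fresh c∈ with s , s∈ , eq ← ∈-map⁻ comp c∈ =
          head∉tail u (subst (_∈ _) (trans (sym (root (there s∈)))
            (trans (sym (label⇒class eq)) (root (here refl)))) s∈)
      complete : ∀ k → k ∈ map comp R
      complete k with v , refl ← proj₂ labelling k =
        subst (_∈ map comp R) (class⇒label (root (cover v))) (∈-map⁺ comp (cover v))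

    circuit⇒¬tree : ∀ {v} → Circuit rep (rep v) → ¬ IsTreeComponent W n comp (comp v)
    circuit⇒¬tree c acyclic = let cyc , in-class = circuit⇒cycle c in
      acyclic (cyc , λ j → class⇒label (in-class j))

    tree⇒isTree : ∀ {T v} → Trees (allFin 8) rep T → rep v ∈ T → IsTreeComponent W n comp (comp v)
    tree⇒isTree {T} trees v∈ (cyc , in-comp) =
      Trees.acyclic trees (subst (_∈ T) (sym (label⇒class (in-comp zero))) v∈) (cycle⇒trail cyc)

  -- With eight edges on eight vertices, `Balanced` forces `T` to be empty and `Overfull` forces it
  -- to be nonempty, so trees are present exactly in the overfull case.
  solutions-by-components : State (allFin 8) → (n : ℕ) (comp : Fin 8 → Fin n) → IsComponentLabelling W n comp →
    ((∀ c → ¬ IsTreeComponent W n comp c) → solutionNumber W ≡ 2 ^ n)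
    × ((∃ λ c → IsTreeComponent W n comp c) → solutionNumber W ≡ 0)
  solutions-by-components st n comp labelling = by-cases T trees counting
    where
    open State st using (rep; T; components; trees; counting)

    by-cases : ∀ T → Trees (allFin 8) rep T →
               (∃ λ U → Balanced (allFin 8) rep T U) ⊎ Overfull (allFin 8) T →
               ((∀ c → ¬ IsTreeComponent W n comp c) → solutionNumber W ≡ 2 ^ n)
               × ((∃ λ c → IsTreeComponent W n comp c) → solutionNumber W ≡ 0)
    by-cases [] trees (inj₁ (U , bal)) =
      -- No tree is left, so `U` represents all components and has length `n`; the empty `F` matches
      -- the empty `T`.
      (λ _ → trans solutionNumber≡count (trans (count≡ [] ↭-refl)
               (cong (2 ^_) (number-of-classes labelling components unique root cover))))
      , λ (c , tree) → contradiction tree (not-tree c)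
      where
      open Balanced bal
      not-tree : ∀ c → ¬ IsTreeComponent W n comp c
      not-tree c = let v , v∈c = proj₂ labelling c in
        subst (λ k → ¬ IsTreeComponent W n comp k) v∈c
          (circuit⇒¬tree labelling components (Trees.cyclic trees {v} (λ ())))
    -- Here `size` would read `suc (length T) + 8 ≡ 8`.
    by-cases (r ∷ T) trees (inj₁ (U , bal)) =
      contradiction (+-cancelʳ-≡ 8 (suc (length T)) 0 (Balanced.size bal)) (λ ())
    -- Here `size` would read `8 < 8`.
    by-cases [] trees (inj₂ over) = contradiction (Overfull.size over) (<-irrefl refl)
    by-cases (r ∷ T) trees (inj₂ over) =
      -- A tree remains, namely the component of `r`.
      (λ no-tree → contradiction
         (tree⇒isTree labelling components trees (subst (_∈ r ∷ T) (sym (Trees.root trees (here refl))) (here refl)))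
         (no-tree (comp r)))
      , λ _ → trans solutionNumber≡count (Overfull.count≡0 over [])

theorem6 : (W : Family)
    → (∀ i → IsMacMahon (W i))
    → (∀ i j → i ≢ j → ¬ SameCube (W i) (W j))
    → numEdges W ≡ 8
    → (n : ℕ) (comp : Fin 8 → Fin n) → IsComponentLabelling W n comp
    → ((∀ c → ¬ IsTreeComponent W n comp c) → solutionNumber W ≡ 2 ^ n)
    × ((∃ λ c → IsTreeComponent W n comp c) → solutionNumber W ≡ 0)
theorem6 W _ _ eight = Cubes.solutions-by-components W isEdge
    (λ i → proj₁ (ends (W i) (isEdge i)))
    (λ i → proj₁ (proj₂ (ends (W i) (isEdge i))))
    (λ i → proj₁ (proj₂ (proj₂ (ends (W i) (isEdge i)))))
    (λ i → proj₂ (proj₂ (proj₂ (ends (W i) (isEdge i)))))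
    (Multigraph.state _ _ (Uniqueₚ.allFin⁺ 8))
  where
  isEdge : ∀ i → IsEdge (W i)
  isEdge = all-edges W eight
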